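{- Let $N$ be an even perfect number with $N \neq 6$. Then $N$ can be written as the sum of $5$ cubes of natural numbers, i.e., there exist natural numbers $x_1, x_2, x_3, x_4, x_5$ (where $0$ is allowed) such that $N = x_1^3 + x_2^3 + x_3^3 + x_4^3 + x_5^3$.
   Context: A perfect number is a positive integer that is equal to the sum of its proper positive divisors (the positive divisors other than the number itself). The natural numbers are $\mathbb{N} = \{0, 1, 2, \dots\}$; in particular $0$ is a natural number, and the $x_i$ need not be distinct. -}

module Defs where

open import Data.List.Base using (List; filter; upTo)
open import Data.Nat.Base using (ℕ; _<_)
open import Data.Nat.Divisibility using (_∣?_)
open import Data.Nat.ListAction using (sum)
open import Data.Product.Base using (_×_)
open import Relation.Binary.PropositionalEquality.Core using (_≡_)

-- upTo n = 0, 1, …, n - 1.  The candidate 0 is never kept, since 0 ∣ n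
-- forces n ≡ 0, and upTo 0 is empty.
properDivisors : ℕ → List ℕ
properDivisors n = filter (_∣? n) (upTo n)

Perfect : ℕ → Set
Perfect n = 0 < n × sum (properDivisors n) ≡ n

{-# OPTIONS --safe #-}

-- Write N = 2^a m with m odd, and let s be the sum of the proper divisors of m.
-- Splitting the divisors of 2n into even and odd ones shows that N is perfect
-- only if m + s = 2^(a+1) s.  Then s is a proper divisor of m which is also the
-- sum of all of them, so s = 1: m = 2^(a+1) - 1 is prime.  If a is odd then
-- 3 ∣ m and N = 6; if a = 6k + 2 then 7 ∣ m and N = 28 = 3³ + 1³.  Otherwise put
-- u = 2^k and use 2u⁶ - 2 = (u² + u - 1)³ + (u² - u - 1)³.  For a = 6k this makes
-- m = 2u⁶ - 1 a sum of three cubes, and N = (u²)³ m.  For a = 6k + 4 we have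
-- N = (2u²)³ (64u⁶ - 2), where 64u⁶ - 2 = (2u⁶ - 2) + 62u⁶ and 62 = 3³ + 3³ + 2³.
module Submission where

open import Defs
open import Data.Nat.Base using (ℕ; _+_; _^_)
open import Data.Nat.Divisibility using (_∣_)
open import Data.Product using (∃-syntax)
open import Relation.Binary.PropositionalEquality using (_≡_; _≢_)

open import Data.Bool.Base using (true; false; if_then_else_)
open import Data.Fin.Base using (zero; suc)
open import Data.List.Base using ([]; _∷_; applyUpTo; filter; map; upTo)
open import Data.List.Properties using (map-upTo)
open import Data.Nat.Base
  using (zero; suc; _*_; _≤_; _<_; s≤s; z≤n; NonZero; >-nonZero; ≢-nonZero⁻¹)
open import Data.Nat.Divisibility
open import Data.Nat.DivMod using (_divMod_; result)
open import Data.Nat.Induction using (<-rec)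
open import Data.Nat.ListAction using (sum)
open import Data.Nat.Properties
open import Data.Nat.Solver using (module +-*-Solver)
open import Data.Product using (_×_; _,_)
open import Data.Sum.Base using (inj₁; inj₂)
open import Function.Base using (_∘_)
open import Relation.Binary.PropositionalEquality
  using (refl; sym; trans; cong; cong₂; subst; module ≡-Reasoning)
open import Relation.Nullary using (yes; no; does; contradiction)
open import Relation.Nullary.Decidable using (dec-true; dec-false)
open import Relation.Unary using (Pred; Decidable)

open +-*-Solver

private
  variable
    d m n : ℕ

-- Finite sums over initial segments of the naturals.

∑ : ℕ → (ℕ → ℕ) → ℕ
∑ k f = sum (applyUpTo f k)

∑-cong : ∀ k {f g : ℕ → ℕ} → (∀ i → f i ≡ g i) → ∑ k f ≡ ∑ k g
∑-cong zero    f≗g = refl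
∑-cong (suc k) f≗g = cong₂ _+_ (f≗g 0) (∑-cong k (f≗g ∘ suc))

∑-zero : ∀ k {f : ℕ → ℕ} → (∀ i → f i ≡ 0) → ∑ k f ≡ 0
∑-zero zero    f≗0 = refl
∑-zero (suc k) f≗0 = cong₂ _+_ (f≗0 0) (∑-zero k (f≗0 ∘ suc))

∑-distribʳ-* : ∀ k (f : ℕ → ℕ) c → ∑ k (λ i → f i * c) ≡ ∑ k f * c
∑-distribʳ-* zero    f c = refl
∑-distribʳ-* (suc k) f c =
  trans (cong (f 0 * c +_) (∑-distribʳ-* k (f ∘ suc) c))
        (sym (*-distribʳ-+ c (f 0) (∑ k (f ∘ suc))))

∑-+ : ∀ k l (f : ℕ → ℕ) → ∑ (k + l) f ≡ ∑ k f + ∑ l (λ i → f (k + i))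
∑-+ zero    l f = refl
∑-+ (suc k) l f =
  trans (cong (f 0 +_) (∑-+ k l (f ∘ suc))) (sym (+-assoc (f 0) _ _))

∑-even-odd : ∀ k (f : ℕ → ℕ) →
  ∑ (k * 2) f ≡ ∑ k (λ i → f (i * 2)) + ∑ k (λ i → f (1 + i * 2))
∑-even-odd zero    f = refl
∑-even-odd (suc k) f =
  trans (cong (λ t → f 0 + (f 1 + t)) (∑-even-odd k (λ i → f (2 + i))))
        (solve 4 (λ a b x y → a :+ (b :+ (x :+ y)) := (a :+ x) :+ (b :+ y))
               refl (f 0) (f 1) _ _)

f[i]≤∑f : ∀ {k i} (f : ℕ → ℕ) → i < k → f i ≤ ∑ k f
f[i]≤∑f {suc k} {zero}  f _         = m≤m+n (f 0) _
f[i]≤∑f {suc k} {suc i} f (s≤s i<k) =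
  ≤-trans (f[i]≤∑f (f ∘ suc) i<k) (m≤n+m _ (f 0))

-- Divisor sums as indexed sums.

sum-filter : ∀ {p} {P : Pred ℕ p} (P? : Decidable P) xs →
  sum (filter P? xs) ≡ sum (map (λ x → if does (P? x) then x else 0) xs)
sum-filter P? []       = refl
sum-filter P? (x ∷ xs) with does (P? x)
... | true  = cong (x +_) (sum-filter P? xs)
... | false = sum-filter P? xs

-- Opaque because the unfolding of _∣?_ would hide n from unification.
opaque
  divisorTerm : ℕ → ℕ → ℕ
  divisorTerm n d = if does (d ∣? n) then d else 0

  divisorTerm-∣ : d ∣ n → divisorTerm n d ≡ d
  divisorTerm-∣ {d} {n} d∣n =
    cong (if_then d else 0) (dec-true (d ∣? n) d∣n)

  divisorTerm-∤ : d ∤ n → divisorTerm n d ≡ 0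
  divisorTerm-∤ {d} {n} d∤n =
    cong (if_then d else 0) (dec-false (d ∣? n) d∤n)

  sum-properDivisors : ∀ n → sum (properDivisors n) ≡ ∑ n (divisorTerm n)
  sum-properDivisors n =
    trans (sum-filter (_∣? n) (upTo n)) (cong sum (map-upTo (divisorTerm n) n))

properDivisorSum : ℕ → ℕ
properDivisorSum n = ∑ n (divisorTerm n)

-- The indices reach every odd number up to `2n - 1`, so for odd `n` the divisor `n` itself is
-- counted, unlike in `properDivisorSum`.
oddDivisorSum : ℕ → ℕ
oddDivisorSum n = ∑ n (λ i → divisorTerm n (1 + i * 2))

-- Even and odd divisors of a double.

-- For `d = 1 + 2i` the identity `d n = 2n i + n` takes the place of a coprimality argument: `d`
-- divides the left side and `2n i`, hence `n`.
odd∣2n⇒odd∣n : ∀ i → 1 + i * 2 ∣ n * 2 → 1 + i * 2 ∣ n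
odd∣2n⇒odd∣n {n} i d∣n2 =
  ∣m+n∣m⇒∣n (subst (1 + i * 2 ∣_) eq (m∣m*n n)) (∣m⇒∣m*n i d∣n2)
  where
  eq : (1 + i * 2) * n ≡ n * 2 * i + n
  eq = solve 2 (λ i n → (con 1 :+ i :* con 2) :* n := n :* con 2 :* i :+ n)
             refl i n

divisorTerm-double-even : ∀ n i →
  divisorTerm (n * 2) (i * 2) ≡ divisorTerm n i * 2
divisorTerm-double-even n i with i ∣? n
... | yes i∣n = trans (divisorTerm-∣ (*-monoˡ-∣ 2 i∣n)) (cong (_* 2) (sym (divisorTerm-∣ i∣n)))
... | no  i∤n = trans (divisorTerm-∤ (i∤n ∘ *-cancelʳ-∣ 2)) (cong (_* 2) (sym (divisorTerm-∤ i∤n)))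

divisorTerm-double-odd : ∀ n i →
  divisorTerm (n * 2) (1 + i * 2) ≡ divisorTerm n (1 + i * 2)
divisorTerm-double-odd n i with (1 + i * 2) ∣? n
... | yes d∣n = trans (divisorTerm-∣ (∣m⇒∣m*n 2 d∣n)) (sym (divisorTerm-∣ d∣n))
... | no  d∤n = trans (divisorTerm-∤ (d∤n ∘ odd∣2n⇒odd∣n i)) (sym (divisorTerm-∤ d∤n))

-- Below `2n`, an even `2i` divides `2n` exactly when `i` divides `n`, and an odd number does
-- exactly when it divides `n`.
properDivisorSum-double : ∀ n →
  properDivisorSum (n * 2) ≡ properDivisorSum n * 2 + oddDivisorSum n
properDivisorSum-double n =
  trans (∑-even-odd n (divisorTerm (n * 2)))
        (cong₂ _+_
          (trans (∑-cong n (divisorTerm-double-even n))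
                 (∑-distribʳ-* n (divisorTerm n) 2))
          (∑-cong n (divisorTerm-double-odd n)))

n*2≡n+n : ∀ n → n * 2 ≡ n + n
n*2≡n+n = solve 1 (λ n → n :* con 2 := n :+ n) refl

oddDivisorSum-double : ∀ n .{{_ : NonZero n}} →
  oddDivisorSum (n * 2) ≡ oddDivisorSum n
oddDivisorSum-double n = begin
  oddDivisorSum (n * 2)                      ≡⟨ ∑-cong (n * 2) (divisorTerm-double-odd n) ⟩
  ∑ (n * 2) t                                ≡⟨ cong (λ k → ∑ k t) (n*2≡n+n n) ⟩
  ∑ (n + n) t                                ≡⟨ ∑-+ n n t ⟩
  oddDivisorSum n + ∑ n (λ i → t (n + i))    ≡⟨ cong (oddDivisorSum n +_) (∑-zero n tail≡0) ⟩
  oddDivisorSum n + 0                        ≡⟨ +-identityʳ _ ⟩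
  oddDivisorSum n                            ∎
  where
  open ≡-Reasoning
  t : ℕ → ℕ
  t i = divisorTerm n (1 + i * 2)
  tail≡0 : ∀ i → t (n + i) ≡ 0
  -- From index `n` on, the candidate `1 + 2(n + i)` exceeds `n`.
  tail≡0 i = divisorTerm-∤
    (>⇒∤ (s≤s (≤-trans (m≤m+n n i) (m≤m*n (n + i) 2))))

-- The divisor terms of `m` over all numbers below `2m` are summed twice. Split by parity, the even
-- half vanishes; split at `m`, the upper half contributes only `m` itself.
oddDivisorSum-odd : ∀ m .{{_ : NonZero m}} → 2 ∤ m →
  oddDivisorSum m ≡ properDivisorSum m + m
oddDivisorSum-odd m@(suc m′) 2∤m = begin
  oddDivisorSum m                              ≡⟨ cong (_+ oddDivisorSum m) (∑-zero m even≡0) ⟨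
  ∑ m (λ i → t (i * 2)) + oddDivisorSum m      ≡⟨ ∑-even-odd m t ⟨
  ∑ (m * 2) t                                  ≡⟨ cong (λ k → ∑ k t) (n*2≡n+n m) ⟩
  ∑ (m + m) t                                  ≡⟨ ∑-+ m m t ⟩
  properDivisorSum m + ∑ m (λ i → t (m + i))   ≡⟨ cong (properDivisorSum m +_) tail≡m ⟩
  properDivisorSum m + m                       ∎
  where
  open ≡-Reasoning
  t : ℕ → ℕ
  t = divisorTerm m
  even≡0 : ∀ i → t (i * 2) ≡ 0
  even≡0 i = divisorTerm-∤ (2∤m ∘ ∣-trans (n∣m*n i))
  tail≡m : ∑ m (λ i → t (m + i)) ≡ m
  tail≡m = trans
    (cong₂ _+_
      (trans (cong t (+-identityʳ m)) (divisorTerm-∣ ∣-refl))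
      (∑-zero m′ (λ i → divisorTerm-∤ (>⇒∤ (m<m+n m (s≤s z≤n))))))
    (+-identityʳ m)

-- The divisor sum of an odd number times a power of two.

module _ (m : ℕ) .{{_ : NonZero m}} where

  private
    σ : ℕ
    σ = oddDivisorSum m

  m*2^suc : ∀ a → m * 2 ^ suc a ≡ m * 2 ^ a * 2
  m*2^suc a = solve 2 (λ m p → m :* (con 2 :* p) := m :* p :* con 2)
                    refl m (2 ^ a)

  oddDivisorSum-2^ : ∀ a → oddDivisorSum (m * 2 ^ a) ≡ σ
  oddDivisorSum-2^ zero    = cong oddDivisorSum (*-identityʳ m)
  oddDivisorSum-2^ (suc a) = begin
    oddDivisorSum (m * 2 ^ suc a)  ≡⟨ cong oddDivisorSum (m*2^suc a) ⟩
    oddDivisorSum (m * 2 ^ a * 2)  ≡⟨ oddDivisorSum-double (m * 2 ^ a) ⟩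
    oddDivisorSum (m * 2 ^ a)      ≡⟨ oddDivisorSum-2^ a ⟩
    σ                              ∎
    where
    open ≡-Reasoning
    instance
      2^a≢0 : NonZero (2 ^ a)
      2^a≢0 = m^n≢0 2 a
      m2^a≢0 : NonZero (m * 2 ^ a)
      m2^a≢0 = m*n≢0 m (2 ^ a)

  -- σ(2^a m) = (2^(a+1) - 1) σ(m) for odd m, with both sides moved so that no
  -- subtraction occurs.
  divisorSum-2^ : 2 ∤ m → ∀ a →
    properDivisorSum (m * 2 ^ a) + m * 2 ^ a + σ ≡ 2 ^ suc a * σ
  divisorSum-2^ 2∤m zero    = begin
    properDivisorSum (m * 1) + m * 1 + σ  ≡⟨ cong (λ x → properDivisorSum x + x + σ) (*-identityʳ m) ⟩
    properDivisorSum m + m + σ            ≡⟨ cong (_+ σ) (oddDivisorSum-odd m 2∤m) ⟨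
    σ + σ                                 ≡⟨ cong (σ +_) (+-identityʳ σ) ⟨
    2 * σ                                 ∎
    where open ≡-Reasoning
  divisorSum-2^ 2∤m (suc a) = begin
    properDivisorSum (m * 2 ^ suc a) + m * 2 ^ suc a + σ
      ≡⟨ cong (λ x → properDivisorSum x + x + σ) (m*2^suc a) ⟩
    properDivisorSum (x * 2) + x * 2 + σ
      ≡⟨ cong (λ s → s + x * 2 + σ) (properDivisorSum-double x) ⟩
    properDivisorSum x * 2 + oddDivisorSum x + x * 2 + σ
      ≡⟨ cong (λ o → properDivisorSum x * 2 + o + x * 2 + σ) (oddDivisorSum-2^ a) ⟩
    properDivisorSum x * 2 + σ + x * 2 + σ
      ≡⟨ solve 3 (λ s x o → s :* con 2 :+ o :+ x :* con 2 :+ o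
                         := con 2 :* (s :+ x :+ o)) refl (properDivisorSum x) x σ ⟩
    2 * (properDivisorSum x + x + σ)
      ≡⟨ cong (2 *_) (divisorSum-2^ 2∤m a) ⟩
    2 * (2 ^ suc a * σ)
      ≡⟨ *-assoc 2 (2 ^ suc a) σ ⟨
    2 ^ suc (suc a) * σ
      ∎
    where
    open ≡-Reasoning
    x : ℕ
    x = m * 2 ^ a

  -- Perfection turns `divisorSum-2^` into `2^(a+1) m + σ = 2^(a+1) σ`. Since `σ = s + m`, the term
  -- `2^(a+1) m` cancels.
  perfect⇒m+s≡2^[1+a]*s : 2 ∤ m → ∀ a →
    properDivisorSum (m * 2 ^ a) ≡ m * 2 ^ a →
    m + properDivisorSum m ≡ 2 ^ suc a * properDivisorSum m
  perfect⇒m+s≡2^[1+a]*s 2∤m a perfect =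
    +-cancelˡ-≡ (2 * p * m) _ _ (begin
      2 * p * m + (m + s)
        ≡⟨ solve 3 (λ p m s → con 2 :* p :* m :+ (m :+ s)
                           := m :* p :+ m :* p :+ (s :+ m)) refl p m s ⟩
      m * p + m * p + (s + m)
        ≡⟨ cong₂ (λ x o → x + m * p + o) perfect σ≡ ⟨
      properDivisorSum (m * p) + m * p + σ
        ≡⟨ divisorSum-2^ 2∤m a ⟩
      2 * p * σ
        ≡⟨ cong (2 * p *_) σ≡ ⟩
      2 * p * (s + m)
        ≡⟨ solve 3 (λ p m s → con 2 :* p :* (s :+ m)
                           := con 2 :* p :* m :+ con 2 :* p :* s) refl p m s ⟩
      2 * p * m + 2 * p * s
        ∎)
    where
    open ≡-Reasoning
    p s : ℕ
    p = 2 ^ a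
    s = properDivisorSum m
    σ≡ : σ ≡ s + m
    σ≡ = oddDivisorSum-odd m 2∤m

-- The shape of even perfect numbers.

-- Both 1 and `d` are proper divisors, and they are distinct, so the sum is at least `1 + d`.
d<properDivisorSum : 1 < d → d < m → d ∣ m → d < properDivisorSum m
d<properDivisorSum {suc (suc e)} {suc (suc k)} (s≤s (s≤s _)) (s≤s (s≤s e<k)) d∣m =
  begin
    1 + suc (suc e)                       ≡⟨ cong₂ _+_ (divisorTerm-∣ (1∣ _)) (divisorTerm-∣ d∣m) ⟨
    t 1 + t (2 + e)                       ≤⟨ +-monoʳ-≤ (t 1) (f[i]≤∑f (λ i → t (2 + i)) e<k) ⟩
    t 1 + ∑ k (λ i → t (2 + i))           ≤⟨ m≤n+m _ (t 0) ⟩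
    t 0 + (t 1 + ∑ k (λ i → t (2 + i)))   ∎
  where
  open ≤-Reasoning
  t : ℕ → ℕ
  t = divisorTerm (suc (suc k))

perfect⇒s≡1 : ∀ m .{{_ : NonZero m}} → 2 ∤ m → ∀ a .{{_ : NonZero a}} →
  properDivisorSum (m * 2 ^ a) ≡ m * 2 ^ a → properDivisorSum m ≡ 1
perfect⇒s≡1 m 2∤m a perfect
  with properDivisorSum m in s≡ | perfect⇒m+s≡2^[1+a]*s m 2∤m a perfect
... | zero        | eq = contradiction
  (m+n≡0⇒m≡0 m (trans eq (*-zeroʳ (2 ^ suc a)))) (≢-nonZero⁻¹ m)
... | suc zero    | eq = refl
... | s@(suc (suc _)) | eq =
  contradiction (d<properDivisorSum (s≤s (s≤s z≤n)) s<m s∣m) (<-irrefl (sym s≡))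
  where
  s∣m : s ∣ m
  s∣m = ∣m+n∣m⇒∣n (divides (2 ^ suc a) (trans (+-comm s m) eq)) ∣-refl
  s<m : s < m
  s<m = +-cancelʳ-< s s m (begin-strict
    s + s           ≡⟨ n*2≡n+n s ⟨
    -- Here `a > 0` gives `2 < 2 ^ suc a`. At `a = 0` the equation would read `m = s`, the case of
    -- an odd perfect number.
    s * 2           <⟨ *-monoʳ-< s (^-monoʳ-< 2 (s≤s (s≤s z≤n)) (s≤s (n≢0⇒n>0 (≢-nonZero⁻¹ a)))) ⟩
    s * 2 ^ suc a   ≡⟨ *-comm s (2 ^ suc a) ⟩
    2 ^ suc a * s   ≡⟨ eq ⟨
    m + s           ∎)
    where open ≤-Reasoning

odd-part : ∀ n .{{_ : NonZero n}} → ∃[ m ] ∃[ a ] (n ≡ m * 2 ^ a × 2 ∤ m)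
odd-part = <-rec (λ n → .{{_ : NonZero n}} → _) step
  where
  step : ∀ n → (∀ {k} → k < n → .{{_ : NonZero k}} →
                  ∃[ m ] ∃[ a ] (k ≡ m * 2 ^ a × 2 ∤ m)) →
         .{{_ : NonZero n}} → ∃[ m ] ∃[ a ] (n ≡ m * 2 ^ a × 2 ∤ m)
  step n rec with 2 ∣? n
  ... | no 2∤n = n , 0 , sym (*-identityʳ n) , 2∤n
  ... | yes 2∣n@(divides k n≡k*2)
    with rec (quotient-< 2∣n) {{quotient≢0 2∣n}}
  ...   | m , a , k≡ , 2∤m =
    m , suc a , trans n≡k*2 (trans (cong (_* 2) k≡) eq) , 2∤m
    where
    eq : m * 2 ^ a * 2 ≡ m * 2 ^ suc a
    eq = solve 2 (λ m p → m :* p :* con 2 := m :* (con 2 :* p)) refl m (2 ^ a)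

-- Primality of `m` is recorded as `properDivisorSum m ≡ 1`, the form in which `s≡1∧d∣m⇒m≡d`
-- consumes it.
even-perfect : 2 ∣ n → Perfect n →
  ∃[ m ] ∃[ a ] (n ≡ m * 2 ^ a × suc m ≡ 2 ^ suc a × properDivisorSum m ≡ 1)
even-perfect {n} 2∣n (0<n , perfect)
  with odd-part n {{>-nonZero 0<n}}
... | m        , zero  , refl , 2∤m = contradiction (subst (2 ∣_) (*-identityʳ m) 2∣n) 2∤m
... | zero     , suc a , refl , 2∤m = contradiction (2 ∣0) 2∤m
... | m@(suc _) , a@(suc _) , refl , 2∤m = m , a , refl , 1+m≡2^[1+a] , s≡1
  where
  perfect′ : properDivisorSum (m * 2 ^ a) ≡ m * 2 ^ a
  perfect′ = trans (sym (sum-properDivisors (m * 2 ^ a))) perfect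
  s≡1 : properDivisorSum m ≡ 1
  s≡1 = perfect⇒s≡1 m 2∤m a perfect′
  1+m≡2^[1+a] : suc m ≡ 2 ^ suc a
  1+m≡2^[1+a] = begin
    suc m                            ≡⟨ +-comm 1 m ⟩
    m + 1                            ≡⟨ cong (m +_) s≡1 ⟨
    m + properDivisorSum m           ≡⟨ perfect⇒m+s≡2^[1+a]*s m 2∤m a perfect′ ⟩
    2 ^ suc a * properDivisorSum m   ≡⟨ cong (2 ^ suc a *_) s≡1 ⟩
    2 ^ suc a * 1                    ≡⟨ *-identityʳ _ ⟩
    2 ^ suc a                        ∎
    where open ≡-Reasoning

-- Small divisors of a Mersenne number.

-- Modulo `d`, `suc d` is 1 and so are its powers. The uses are `4 ^ j` with `d = 3` and `8 ^ j`
-- with `d = 7`.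
[1+d]^j≡1+q*d : ∀ d j → ∃[ q ] suc d ^ j ≡ suc (q * d)
[1+d]^j≡1+q*d d zero    = 0 , refl
[1+d]^j≡1+q*d d (suc j) with [1+d]^j≡1+q*d d j
... | q , eq = 1 + q + q * d , trans (cong (suc d *_) eq)
  (solve 2 (λ d q → (con 1 :+ d) :* (con 1 :+ q :* d)
                 := con 1 :+ (con 1 :+ q :+ q :* d) :* d) refl d q)

1+m≡[1+d]^j⇒d∣m : ∀ j → suc m ≡ suc d ^ j → d ∣ m
1+m≡[1+d]^j⇒d∣m {d = d} j eq with [1+d]^j≡1+q*d d j
... | q , eq′ = divides q (suc-injective (trans eq eq′))

s≡1∧d∣m⇒m≡d : .{{_ : NonZero m}} → properDivisorSum m ≡ 1 → 1 < d → d ∣ m → m ≡ d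
s≡1∧d∣m⇒m≡d s≡1 1<d d∣m with m≤n⇒m<n∨m≡n (∣⇒≤ d∣m)
... | inj₂ d≡m = sym d≡m
... | inj₁ d<m = contradiction
  (<-trans 1<d (d<properDivisorSum 1<d d<m d∣m)) (<-irrefl (sym s≡1))

-- Cube identities.

-- With `A = u² - 1`, the cubes of `A + u` and `A - u` add up to `2A(A² + 3u²) = 2(u² - 1)(u⁴ + u² +
-- 1) = 2u⁶ - 2`.
2u⁶≡2+x³+y³ : ∀ u .{{_ : NonZero u}} → ∃[ x ] ∃[ y ] 2 * u ^ 6 ≡ 2 + x ^ 3 + y ^ 3
-- At `u = 1` the entries would be 1 and -1; their cubes cancel, so two zeros replace them.
2u⁶≡2+x³+y³ 1             = 0 , 0 , refl
-- With u = 2 + v the two entries are u² + u - 1 and u² - u - 1.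
2u⁶≡2+x³+y³ (suc (suc v)) = v * v + 5 * v + 5 , v * v + 3 * v + 1 ,
  solve 1 (λ v → con 2 :* (con 2 :+ v) :^ 6
              := con 2 :+ (v :* v :+ con 5 :* v :+ con 5) :^ 3
                       :+ (v :* v :+ con 3 :* v :+ con 1) :^ 3) refl v

SumOfFiveCubes : ℕ → Set
SumOfFiveCubes n = ∃[ x₁ ] ∃[ x₂ ] ∃[ x₃ ] ∃[ x₄ ] ∃[ x₅ ]
  n ≡ x₁ ^ 3 + x₂ ^ 3 + x₃ ^ 3 + x₄ ^ 3 + x₅ ^ 3

five-cubes-6k : ∀ u .{{_ : NonZero u}} → suc m ≡ 2 * u ^ 6 →
  SumOfFiveCubes (m * u ^ 6)
five-cubes-6k {m} u 1+m≡ with 2u⁶≡2+x³+y³ u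
... | x , y , eq = u ^ 2 , u ^ 2 * x , u ^ 2 * y , 0 , 0 ,
  trans (cong (_* u ^ 6) (suc-injective (trans 1+m≡ eq)))
    (solve 3 (λ u x y → (con 1 :+ x :^ 3 :+ y :^ 3) :* u :^ 6
                     := (u :^ 2) :^ 3 :+ (u :^ 2 :* x) :^ 3 :+ (u :^ 2 :* y) :^ 3
                        :+ con 0 :+ con 0) refl u x y)

five-cubes-6k+4 : ∀ u .{{_ : NonZero u}} → suc m ≡ 32 * u ^ 6 →
  SumOfFiveCubes (m * (16 * u ^ 6))
five-cubes-6k+4 {m} u 1+m≡ with 2u⁶≡2+x³+y³ u
-- The factor `8u⁶` is `(2u²)³`, and `62u⁶` is the sum of the cubes of `3u²`, `3u²` and `2u²`;
-- scaling these by `2u²` gives the first three witnesses.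
... | x , y , eq = 6 * u ^ 4 , 6 * u ^ 4 , 4 * u ^ 4 , 2 * u ^ 2 * x , 2 * u ^ 2 * y , (begin
  m * (16 * u ^ 6)
    ≡⟨ solve 2 (λ m w → m :* (con 16 :* w) := con 2 :* m :* (con 8 :* w)) refl m (u ^ 6) ⟩
  2 * m * (8 * u ^ 6)
    ≡⟨ cong (_* (8 * u ^ 6)) 2m≡ ⟩
  (62 * u ^ 6 + x ^ 3 + y ^ 3) * (8 * u ^ 6)
    ≡⟨ solve 3 (λ u x y →
         (con 62 :* u :^ 6 :+ x :^ 3 :+ y :^ 3) :* (con 8 :* u :^ 6)
         := (con 6 :* u :^ 4) :^ 3 :+ (con 6 :* u :^ 4) :^ 3 :+ (con 4 :* u :^ 4) :^ 3
            :+ (con 2 :* u :^ 2 :* x) :^ 3 :+ (con 2 :* u :^ 2 :* y) :^ 3) refl u x y ⟩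
  (6 * u ^ 4) ^ 3 + (6 * u ^ 4) ^ 3 + (4 * u ^ 4) ^ 3
    + (2 * u ^ 2 * x) ^ 3 + (2 * u ^ 2 * y) ^ 3
    ∎)
  where
  open ≡-Reasoning
  2m≡ : 2 * m ≡ 62 * u ^ 6 + x ^ 3 + y ^ 3
  2m≡ = +-cancelˡ-≡ 2 _ _ (begin
    2 + 2 * m                           ≡⟨ *-suc 2 m ⟨
    2 * suc m                           ≡⟨ cong (2 *_) 1+m≡ ⟩
    2 * (32 * u ^ 6)                    ≡⟨ solve 1 (λ w → con 2 :* (con 32 :* w)
                                                        := con 62 :* w :+ con 2 :* w) refl (u ^ 6) ⟩
    62 * u ^ 6 + 2 * u ^ 6              ≡⟨ cong (62 * u ^ 6 +_) eq ⟩
    62 * u ^ 6 + (2 + x ^ 3 + y ^ 3)    ≡⟨ solve 3 (λ w x y → w :+ (con 2 :+ x :+ y)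
                                                  := con 2 :+ (w :+ x :+ y))
                                                  refl (62 * u ^ 6) (x ^ 3) (y ^ 3) ⟩
    2 + (62 * u ^ 6 + x ^ 3 + y ^ 3)    ∎)

-- Case distinction on the exponent modulo 6.

theorem1 : ∀ (N : ℕ) → 2 ∣ N → Perfect N → N ≢ 6 →
    ∃[ x₁ ] ∃[ x₂ ] ∃[ x₃ ] ∃[ x₄ ] ∃[ x₅ ]
    N ≡ x₁ ^ 3 + x₂ ^ 3 + x₃ ^ 3 + x₄ ^ 3 + x₅ ^ 3
theorem1 N 2∣N perfect N≢6 with even-perfect 2∣N perfect
-- The result of `even-perfect` does not state that `m` is nonzero; for `m = 0` the number reduces
-- to 0, a sum of zero cubes.
... | zero , a , refl , _ , _ = 0 , 0 , 0 , 0 , 0 , refl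
... | m@(suc _) , a , refl , 1+m≡ , s≡1 = cases (a divMod 6)
  where
  -- Now `suc m = 4 ^ j`, so 3 divides `m` and `m = 3`; then `2 * 2 ^ a = 4` and `N = 3 * 2`, which
  -- is excluded.
  a-odd-impossible : ∀ j → suc a ≡ 2 * j → SumOfFiveCubes (m * 2 ^ a)
  a-odd-impossible j 1+a≡2j = contradiction (cong₂ _*_ m≡3 2^a≡2) N≢6
    where
    m≡3 : m ≡ 3
    m≡3 = s≡1∧d∣m⇒m≡d s≡1 (s≤s (s≤s z≤n)) (1+m≡[1+d]^j⇒d∣m j
      (trans 1+m≡ (trans (cong (2 ^_) 1+a≡2j) (sym (^-*-assoc 2 2 j)))))
    2^a≡2 : 2 ^ a ≡ 2
    2^a≡2 = *-cancelˡ-≡ (2 ^ a) 2 2 (trans (sym 1+m≡) (cong suc m≡3))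

  -- Now `suc m = 8 ^ j`, so `m = 7`, `2 ^ a = 4` and `N = 28 = 27 + 1`.
  28-case : ∀ j → suc a ≡ 3 * j → SumOfFiveCubes (m * 2 ^ a)
  28-case j 1+a≡3j = 3 , 1 , 0 , 0 , 0 , cong₂ _*_ m≡7 2^a≡4
    where
    m≡7 : m ≡ 7
    m≡7 = s≡1∧d∣m⇒m≡d s≡1 (s≤s (s≤s z≤n)) (1+m≡[1+d]^j⇒d∣m j
      (trans 1+m≡ (trans (cong (2 ^_) 1+a≡3j) (sym (^-*-assoc 2 3 j)))))
    2^a≡4 : 2 ^ a ≡ 4
    2^a≡4 = *-cancelˡ-≡ (2 ^ a) 4 2 (trans (sym 1+m≡) (cong suc m≡7))

  -- Residues 0 and 4 use the cube identities with `u = 2 ^ k`; residues 1, 3, 5 make `suc a` even,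
  -- and residue 2 makes it a multiple of 3.
  cases : _ → SumOfFiveCubes (m * 2 ^ a)
  cases (result k zero a≡) =
    subst (λ w → SumOfFiveCubes (m * w)) (sym 2^a≡)
      (five-cubes-6k (2 ^ k) {{m^n≢0 2 k}} (trans 1+m≡ (cong (2 *_) 2^a≡)))
    where
    2^a≡ : 2 ^ a ≡ (2 ^ k) ^ 6
    2^a≡ = trans (cong (2 ^_) a≡) (sym (^-*-assoc 2 k 6))
  cases (result k (suc (suc (suc (suc zero)))) a≡) =
    subst (λ w → SumOfFiveCubes (m * w)) (sym 2^a≡)
      (five-cubes-6k+4 (2 ^ k) {{m^n≢0 2 k}}
        (trans 1+m≡ (trans (cong (2 *_) 2^a≡) (sym (*-assoc 2 16 ((2 ^ k) ^ 6))))))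
    where
    2^a≡ : 2 ^ a ≡ 16 * (2 ^ k) ^ 6
    2^a≡ = trans (cong (2 ^_) a≡)
      (trans (^-distribˡ-+-* 2 4 (k * 6)) (cong (16 *_) (sym (^-*-assoc 2 k 6))))
  cases (result k (suc zero) a≡) = a-odd-impossible (1 + k * 3) (trans (cong suc a≡)
    (solve 1 (λ k → con 2 :+ k :* con 6 := con 2 :* (con 1 :+ k :* con 3)) refl k))
  cases (result k (suc (suc (suc zero))) a≡) = a-odd-impossible (2 + k * 3) (trans (cong suc a≡)
    (solve 1 (λ k → con 4 :+ k :* con 6 := con 2 :* (con 2 :+ k :* con 3)) refl k))
  cases (result k (suc (suc (suc (suc (suc zero))))) a≡) = a-odd-impossible (3 + k * 3) (trans (cong suc a≡)
    (solve 1 (λ k → con 6 :+ k :* con 6 := con 2 :* (con 3 :+ k :* con 3)) refl k))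
  cases (result k (suc (suc zero)) a≡) = 28-case (1 + k * 2) (trans (cong suc a≡)
    (solve 1 (λ k → con 3 :+ k :* con 6 := con 3 :* (con 1 :+ k :* con 2)) refl k))
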